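{- Let $n\ge1$, $l\in\{0,\dots,2n\}$ and $t\in\{0,\dots,n\}$ be such that $0\le t\le\min\{l,2n-l\}$ and $l-t$ is even. Let $\mathbf a=(a_1,\dots,a_t)\in SpT_{2n}(\varpi_t)$ be such that $\mathbf s(a_i)\notin\mathbf a$ for every $1\le i\le t$. Define integers $l_1,\dots,l_{t+1}$ by (if $t\ge1$) $$l_1=\begin{cases}\min\{a_1-2,\ l-t\},& a_1\text{ even}\\ \min\{a_1-1,\ l-t\},& a_1\text{ odd,}\end{cases}$$ for $1\le i<t$, $$l_{i+1}=\begin{cases}\min\{a_{i+1}-a_i-2,\ l-t-\sum_{k=1}^i l_k\},& a_i,a_{i+1}\text{ both even or both odd}\\ \min\{a_{i+1}-a_i-1,\ l-t-\sum_{k=1}^i l_k\},& a_i\text{ even},\ a_{i+1}\text{ odd}\\ \min\{a_{i+1}-a_i-3,\ l-t-\sum_{k=1}^i l_k\},& a_i\text{ odd},\ a_{i+1}\text{ even,}\end{cases}$$ and $l_{t+1}=l-t-\sum_{i=1}^t l_i$ (so $l_1=l$ if $t=0$). Then $l_1,\dots,l_{t+1}$ are nonnegative even numbers. Put $T_0=(1,2,\dots,l_1)$ and, for $1\le i\le t$, $$T_i=\begin{cases}(a_i+1,\ a_i+2,\dots,a_i+l_{i+1}),& a_i\text{ even}\\ (a_i+1+1,\ a_i+1+2,\dots,a_i+1+l_{i+1}),& a_i\text{ odd}\end{cases}$$ (empty if the corresponding $l$ is $0$), and let $T$ be the concatenation $$T=T_0\,(a_1)\,T_1\,(a_2)\,T_2\cdots(a_t)\,T_t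 .$$ Then $T\in SST_{2n}(\varpi_l)$ and $\mathrm{red}(T)=\mathbf a$; that is, $T=\mathrm{red}_t^{ -1}(\mathbf a)$ is the unique preimage of $\mathbf a$ in $SST_{2n}(\varpi_l)$ under the reduction map.
   Context: $SST_{2n}(\varpi_l)$ is the set of columns of length $l$ on the alphabet $\{1,\dots,2n\}$, i.e. strictly increasing sequences $(b_1<\dots<b_l)$ with entries in $\{1,\dots,2n\}$, often identified with the set of entries. $SpT_{2n}(\varpi_t)\subseteq SST_{2n}(\varpi_t)$ is the subset of symplectic columns: $b_k\ge2k-1$ for all $k$. The parity involution is $\mathbf s(x)=x+1$ for $x$ odd, $\mathbf s(x)=x-1$ for $x$ even. For a column $\mathbf b=(b_1,\dots,b_l)$ the removal subword $\mathrm{rem}(\mathbf b)$ is defined recursively: $\mathrm{rem}(\mathbf b)=\emptyset$ if $l\le1$; if $l\ge2$, $b_l$ is even, $b_{l-1}=b_l-1$ and $b_l<2l-|\mathrm{rem}(b_1,\dots,b_{l-2})|-1$, then $\mathrm{rem}(\mathbf b)=\mathrm{rem}(b_1,\dots,b_{l-2})\cup\{b_{l-1},b_l\}$; otherwise $\mathrm{rem}(\mathbf b)=\mathrm{rem}(b_1,\dots,b_{l-1})$. The reduction of $\mathbf b$ is $\mathrm{red}(\mathbf b)=\mathbf b\setminus\mathrm{rem}(\mathbf b)$. It is known (Watanabe) that $\mathrm{red}$ is injective on $SST_{2n}(\varpi_l)$ and takes values in $\bigsqcup_t SpT_{2n}(\varpi_t)$ over $0\le t\le\min\{l,2n-l\}$,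 $l-t$ even; $\mathrm{red}_t^{ -1}(\mathbf a)=T$ means $T\in SST_{2n}(\varpi_l)$ and $\mathrm{red}(T)=\mathbf a$. -}

module Defs where

open import Data.Nat.Base using (ℕ; suc; pred; _+_; _*_; _∸_; _≤_; _<_; parity)
import Data.Nat.Properties as ℕ
open import Data.Integer.Base as ℤ using (ℤ; +_; -[1+_])
open import Data.Parity.Base using (Parity; 0ℙ; 1ℙ)
import Data.Parity.Properties as ℙ
open import Data.Fin.Base using (Fin; toℕ)
open import Data.Bool.Base using (if_then_else_)
open import Data.List.Base
  using (List; []; _∷_; _++_; length; lookup; reverse; filter; applyUpTo; concat; zipWith)
open import Data.List.Membership.DecPropositional ℕ._≟_ using (_∈?_)
open import Data.List.Relation.Unary.All using (All)
open import Data.List.Relation.Unary.Linked using (Linked)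
open import Data.Product.Base using (_×_)
open import Relation.Nullary using (Dec; does; ¬?; _×-dec_)
open import Relation.Binary.PropositionalEquality using (_≡_)

record IsSST (n l : ℕ) (b : List ℕ) : Set where
  field
    length≡    : length b ≡ l
    increasing : Linked _<_ b
    bounded    : All (λ x → 1 ≤ x × x ≤ 2 * n) b

-- The index i counts from 0, so b_k ≥ 2k - 1 with k = i + 1 reads 2i + 1 ≤ b_k.
record IsSpT (n t : ℕ) (b : List ℕ) : Set where
  field
    isSST      : IsSST n t b
    symplectic : ∀ (i : Fin (length b)) → 2 * toℕ i + 1 ≤ lookup b i

𝐬 : ℕ → ℕ
𝐬 x with parity x
... | 1ℙ = suc x
... | 0ℙ = pred x

-- For a column of length l ending in x , y, with r the cardinality of the
-- removal subword of its first l - 2 entries.  Truncated subtraction is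
-- harmless: the strict inequality fails anyway when 2l - r - 1 is negative.
Removable : (l r x y : ℕ) → Set
Removable l r x y = parity y ≡ 0ℙ × suc x ≡ y × y < 2 * l ∸ r ∸ 1

removable? : ∀ l r x y → Dec (Removable l r x y)
removable? l r x y =
  (parity y ℙ.≟ 0ℙ) ×-dec (suc x ℕ.≟ y) ×-dec (y ℕ.<? 2 * l ∸ r ∸ 1)

-- The recursion consumes a column from its last entry, so it is carried out on
-- the reversed column.  Entries of a column are distinct, so the union is
-- disjoint and length computes the cardinality.
remʳ : List ℕ → List ℕ
remʳ []          = []
remʳ (_ ∷ [])    = []
remʳ (y ∷ x ∷ b) =
  if does (removable? (length (y ∷ x ∷ b)) (length (remʳ b)) x y)
  then y ∷ x ∷ remʳ b
  else remʳ (x ∷ b)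

rem : List ℕ → List ℕ
rem b = reverse (remʳ (reverse b))

red : List ℕ → List ℕ
red b = filter (λ x → ¬? (x ∈? rem b)) b

IsPreimage : (n l : ℕ) (a T : List ℕ) → Set
IsPreimage n l a T = IsSST n l T × red T ≡ a

firstGap : ℕ → ℤ
firstGap a₁ with parity a₁
... | 0ℙ = + a₁ ℤ.- + 2
... | 1ℙ = + a₁ ℤ.- + 1

gap : ℕ → ℕ → ℤ
gap a a′ with parity a | parity a′
... | 0ℙ | 0ℙ = + a′ ℤ.- + a ℤ.- + 2
... | 1ℙ | 1ℙ = + a′ ℤ.- + a ℤ.- + 2
... | 0ℙ | 1ℙ = + a′ ℤ.- + a ℤ.- + 1
... | 1ℙ | 0ℙ = + a′ ℤ.- + a ℤ.- + 3

-- The list l_{i+1}, …, l_{t+1}, given l, t, the sum σ = l_1 + … + l_i, the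
-- entry a_i, and the remaining entries a_{i+1}, …, a_t.
laterLengths : (l t : ℕ) (σ : ℤ) (aᵢ : ℕ) → List ℕ → List ℤ
laterLengths l t σ aᵢ []       = (+ l ℤ.- + t ℤ.- σ) ∷ []
laterLengths l t σ aᵢ (a ∷ as) = lᵢ₊₁ ∷ laterLengths l t (σ ℤ.+ lᵢ₊₁) a as
  where
  lᵢ₊₁ : ℤ
  lᵢ₊₁ = gap aᵢ a ℤ.⊓ (+ l ℤ.- + t ℤ.- σ)

-- The list l_1, …, l_{t+1}, kept in ℤ so that nonnegativity is not automatic.
runLengths : (l t : ℕ) → List ℕ → List ℤ
runLengths l t []       = (+ l ℤ.- + t) ∷ []
runLengths l t (a₁ ∷ as) = l₁ ∷ laterLengths l t l₁ a₁ as
  where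
  l₁ : ℤ
  l₁ = firstGap a₁ ℤ.⊓ (+ l ℤ.- + t)

-- run c k = (c + 1, …, c + k), which is empty when k ≤ 0.
run : ℕ → ℤ → List ℕ
run c (+ k)    = applyUpTo (λ j → c + suc j) k
run c -[1+ _ ] = []

runAfter : ℕ → ℤ → List ℕ
runAfter a k with parity a
... | 0ℙ = run a k
... | 1ℙ = run (a + 1) k

-- assemble (l_1, …, l_{t+1}) (a_1, …, a_t) = T_0 (a_1) T_1 ⋯ (a_t) T_t.
assemble : List ℤ → List ℕ → List ℕ
assemble []       as = []
assemble (k ∷ ks) as = run 0 k ++ concat (zipWith (λ a kₐ → a ∷ runAfter a kₐ) as ks)

preimage : (l t : ℕ) → List ℕ → List ℕ
preimage l t a = assemble (runLengths l t a) a

{-# OPTIONS --safe #-}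

-- Group the possible entries into the pairs {1,2}, {3,4}, …, and read an empty
-- pair as an opening bracket and a full pair as a closing bracket.  Scanning a
-- column from left to right, the pair {x, x+1} is removed exactly when the
-- number d of unmatched opening brackets to its left is zero: this follows from
-- the invariant 2·(length) + 2d = x - 1 + |rem| of the prefix before x.  Thus
-- red empties the unmatched full pairs.  If the result a has no full pair, then
-- no full pair of T comes after an empty one, so T arises from a by filling the
-- first (l - t)/2 empty pairs, which is what the run lengths describe.
module Submission where

open import Defs
open import Data.Nat.Base using (ℕ; zero; suc; pred; _+_; _*_; _∸_; _⊓_; _≤_; _<_; z≤n; s≤s; parity)
import Data.Nat.Properties as ℕ
open import Data.Nat.Divisibility using (_∣_; divides)
import Data.Nat.Tactic.RingSolver as ℕ-Solver
open import Data.Integer.Base as ℤ using (ℤ; 0ℤ; +_)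
open import Data.Integer.Divisibility as ℤ using ()
import Data.Integer.Properties as ℤ
import Data.Integer.Tactic.RingSolver as ℤ-Solver
open import Data.Parity.Base using (0ℙ; 1ℙ)
open import Data.List.Base using (List; []; _∷_; _++_; _ʳ++_; length; map; reverse; filter; applyUpTo; concat; zipWith)
import Data.List.Properties as List
open import Data.List.Membership.Propositional using (_∈_; _∉_)
open import Data.List.Membership.DecPropositional ℕ._≟_ using (_∈?_)
open import Data.List.Relation.Unary.All as All using (All; []; _∷_)
import Data.List.Relation.Unary.All.Properties as All
open import Data.List.Relation.Unary.Any using (here; there)
open import Data.List.Relation.Unary.Linked as Linked using (Linked; [-]; _∷_)
open import Data.Product.Base using (_×_; _,_; ∃-syntax)
open import Function.Base using (_∘_)
open import Relation.Nullary using (¬_; ¬?; Dec; yes; no; contradiction)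
open import Relation.Nullary.Decidable using (dec-true; dec-false)
open import Relation.Binary.PropositionalEquality
  using (_≡_; _≢_; refl; sym; trans; cong; cong₂; subst; module ≡-Reasoning)

-- Slot sequences, their reduction and the filling of empty slots

data Slot : Set where
  none odd even full : Slot

-- The i-th slot (from 0) records which of b + 2i + 1, b + 2i + 2 are entries.
decode : ℕ → List Slot → List ℕ
decode b []          = []
decode b (none ∷ cs) = decode (2 + b) cs
decode b (odd  ∷ cs) = suc b ∷ decode (2 + b) cs
decode b (even ∷ cs) = 2 + b ∷ decode (2 + b) cs
decode b (full ∷ cs) = suc b ∷ 2 + b ∷ decode (2 + b) cs

NoFull : List Slot → Set
NoFull = All (_≢ full)

empties : List Slot → ℕ
empties []          = 0
empties (none ∷ cs) = suc (empties cs)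
empties (odd  ∷ cs) = empties cs
empties (even ∷ cs) = empties cs
empties (full ∷ cs) = empties cs

-- d counts the unmatched empty slots to the left.
reduce : ℕ → List Slot → List Slot
reduce d       []          = []
reduce d       (none ∷ cs) = none ∷ reduce (suc d) cs
reduce d       (odd  ∷ cs) = odd ∷ reduce d cs
reduce d       (even ∷ cs) = even ∷ reduce d cs
reduce zero    (full ∷ cs) = none ∷ reduce zero cs
reduce (suc d) (full ∷ cs) = full ∷ reduce d cs

-- The entries of the full slots that `reduce` empties, governed by the same counter `d`.
removed : ℕ → ℕ → List Slot → List ℕ
removed b d       []          = []
removed b d       (none ∷ cs) = removed (2 + b) (suc d) cs
removed b d       (odd  ∷ cs) = removed (2 + b) d cs
removed b d       (even ∷ cs) = removed (2 + b) d cs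
removed b zero    (full ∷ cs) = suc b ∷ 2 + b ∷ removed (2 + b) zero cs
removed b (suc d) (full ∷ cs) = removed (2 + b) d cs

-- A surplus `k` at the end is discarded, whence the bound `k ≤ empties cs` in the lemmas that count
-- entries.
fill : ℕ → List Slot → List Slot
fill k       []          = []
fill k       (odd  ∷ cs) = odd ∷ fill k cs
fill k       (even ∷ cs) = even ∷ fill k cs
fill k       (full ∷ cs) = full ∷ fill k cs
fill zero    (none ∷ cs) = none ∷ fill zero cs
fill (suc k) (none ∷ cs) = full ∷ fill k cs

parity-suc-even : ∀ b → parity b ≡ 0ℙ → parity (suc b) ≡ 1ℙ
parity-suc-even zero          _ = refl
parity-suc-even (suc (suc b)) p = parity-suc-even b p

parity-suc-odd : ∀ b → parity b ≡ 1ℙ → parity (suc b) ≡ 0ℙ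
parity-suc-odd (suc zero)    _ = refl
parity-suc-odd (suc (suc b)) p = parity-suc-odd b p

-- Columns as slot sequences

decode-increasing : ∀ {c} b cs → c ≤ b → Linked _<_ (c ∷ decode b cs)
decode-increasing b []          c≤b = [-]
decode-increasing b (none ∷ cs) c≤b = decode-increasing (2 + b) cs (ℕ.m≤n⇒m≤o+n 2 c≤b)
decode-increasing b (odd  ∷ cs) c≤b =
  s≤s c≤b ∷ decode-increasing (2 + b) cs (ℕ.n≤1+n _)
decode-increasing b (even ∷ cs) c≤b =
  ℕ.m≤n⇒m≤1+n (s≤s c≤b) ∷ decode-increasing (2 + b) cs ℕ.≤-refl
decode-increasing b (full ∷ cs) c≤b =
  s≤s c≤b ∷ ℕ.≤-refl ∷ decode-increasing (2 + b) cs ℕ.≤-refl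

decode-> : ∀ b cs → All (b <_) (decode b cs)
decode->-suc² : ∀ b cs → All (b <_) (decode (2 + b) cs)

decode-> b []          = []
decode-> b (none ∷ cs) = decode->-suc² b cs
decode-> b (odd  ∷ cs) = ℕ.≤-refl ∷ decode->-suc² b cs
decode-> b (even ∷ cs) = ℕ.n≤1+n _ ∷ decode->-suc² b cs
decode-> b (full ∷ cs) = ℕ.≤-refl ∷ ℕ.n≤1+n _ ∷ decode->-suc² b cs

decode->-suc² b cs = All.map (ℕ.<-trans (ℕ.m<n⇒m<1+n ℕ.≤-refl)) (decode-> (2 + b) cs)

decode-≤ : ∀ b cs → All (_≤ length cs * 2 + b) (decode b cs)
decode-≤ b []       = []
decode-≤ b (c ∷ cs) = extend c
  where
  m = length cs * 2
  rest : All (_≤ 2 + m + b) (decode (2 + b) cs)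
  rest = subst (λ u → All (_≤ u) (decode (2 + b) cs))
               (trans (ℕ.+-suc m (suc b)) (cong suc (ℕ.+-suc m b))) (decode-≤ (2 + b) cs)
  top : 2 + b ≤ 2 + m + b
  top = s≤s (s≤s (ℕ.m≤n+m b m))
  extend : ∀ c → All (_≤ 2 + m + b) (decode b (c ∷ cs))
  extend none = rest
  extend odd  = ℕ.<⇒≤ top ∷ rest
  extend even = top ∷ rest
  extend full = ℕ.<⇒≤ top ∷ top ∷ rest

-- Either way `suc b` becomes the new lower bound, so splitting twice decides one slot.
data Split (b : ℕ) : List ℕ → Set where
  hit  : ∀ {a} → Linked _<_ (suc b ∷ a) → Split b (suc b ∷ a)
  miss : ∀ {a} → Linked _<_ (suc b ∷ a) → Split b a

split : ∀ {b a} → Linked _<_ (b ∷ a) → Split b a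
split [-] = miss [-]
split {b} {x ∷ a} (b<x ∷ inc) with suc b ℕ.≟ x
... | yes refl  = hit inc
... | no  1+b≢x = miss (ℕ.≤∧≢⇒< b<x 1+b≢x ∷ inc)

-- The bound leaves room for exactly `m` slots; written `m * 2 + b`, it unfolds by two for each
-- slot.
encode : ∀ m b {a} → Linked _<_ (b ∷ a) → All (_≤ m * 2 + b) a →
         ∃[ cs ] length cs ≡ m × decode b cs ≡ a
encode zero    b [-]         []        = [] , refl , refl
encode zero    b (b<x ∷ inc) (x≤b ∷ _) = contradiction x≤b (ℕ.<⇒≱ b<x)
encode (suc m) b {a} inc bnd = go (split inc)
  where
  rebase : ∀ {xs} → All (_≤ 2 + m * 2 + b) xs → All (_≤ m * 2 + (2 + b)) xs
  rebase {xs} = subst (λ u → All (_≤ u) xs)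
    (sym (trans (ℕ.+-suc (m * 2) (suc b)) (cong suc (ℕ.+-suc (m * 2) b))))
  go : Split b a → ∃[ cs ] length cs ≡ suc m × decode b cs ≡ a
  go (hit inc₁) with split inc₁
  ... | hit inc₂ with encode m (2 + b) inc₂ (rebase (All.tail (All.tail bnd)))
  ...   | cs , len , eq = full ∷ cs , cong suc len , cong (λ as → suc b ∷ 2 + b ∷ as) eq
  go (hit inc₁) | miss inc₂ with encode m (2 + b) inc₂ (rebase (All.tail bnd))
  ...   | cs , len , eq = odd ∷ cs , cong suc len , cong (suc b ∷_) eq
  go (miss inc₁) with split inc₁
  ... | hit inc₂ with encode m (2 + b) inc₂ (rebase (All.tail bnd))
  ...   | cs , len , eq = even ∷ cs , cong suc len , cong (2 + b ∷_) eq
  go (miss inc₁) | miss inc₂ with encode m (2 + b) inc₂ (rebase bnd)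
  ...   | cs , len , eq = none ∷ cs , cong suc len , eq

encode-SST : ∀ {n l a} → IsSST n l a → ∃[ cs ] length cs ≡ n × decode 0 cs ≡ a
encode-SST {n} {a = a} sst = encode n 0 (from-0 bounded increasing) (All.map upper bounded)
  where
  open IsSST sst
  from-0 : ∀ {xs} → All (λ x → 1 ≤ x × x ≤ 2 * n) xs → Linked _<_ xs → Linked _<_ (0 ∷ xs)
  from-0 []             _   = [-]
  from-0 ((1≤x , _) ∷ _) inc = 1≤x ∷ inc
  upper : ∀ {x} → 1 ≤ x × x ≤ 2 * n → x ≤ n * 2 + 0
  upper (_ , x≤2n) = ℕ.≤-trans x≤2n (ℕ.≤-reflexive (trans (ℕ.*-comm 2 n) (sym (ℕ.+-identityʳ _))))

decode-SST : ∀ cs → IsSST (length cs) (length (decode 0 cs)) (decode 0 cs)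
decode-SST cs = record
  { length≡    = refl
  ; increasing = Linked.tail (decode-increasing 0 cs z≤n)
  ; bounded    = All.zip (decode-> 0 cs , All.map upper (decode-≤ 0 cs))
  }
  where
  upper : ∀ {x} → x ≤ length cs * 2 + 0 → x ≤ 2 * length cs
  upper x≤ = ℕ.≤-trans x≤ (ℕ.≤-reflexive (trans (ℕ.+-identityʳ _) (ℕ.*-comm (length cs) 2)))

𝐬-odd : ∀ b → parity b ≡ 0ℙ → 𝐬 (suc b) ≡ 2 + b
𝐬-odd b p rewrite parity-suc-even b p = refl

-- Since `b` is even, `𝐬` sends the odd entry of a full slot to its even entry, which is present as
-- well.
𝐬-free⇒NoFull : ∀ b cs → parity b ≡ 0ℙ →
                (∀ x → x ∈ decode b cs → 𝐬 x ∉ decode b cs) → NoFull cs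
𝐬-free⇒NoFull b []          p free = []
𝐬-free⇒NoFull b (none ∷ cs) p free = (λ ()) ∷ 𝐬-free⇒NoFull (2 + b) cs p free
𝐬-free⇒NoFull b (odd  ∷ cs) p free =
  (λ ()) ∷ 𝐬-free⇒NoFull (2 + b) cs p (λ x x∈ sx∈ → free x (there x∈) (there sx∈))
𝐬-free⇒NoFull b (even ∷ cs) p free =
  (λ ()) ∷ 𝐬-free⇒NoFull (2 + b) cs p (λ x x∈ sx∈ → free x (there x∈) (there sx∈))
𝐬-free⇒NoFull b (full ∷ cs) p free =
  contradiction (there (here (𝐬-odd b p))) (free (suc b) (here refl))

-- The reduction map

remʳ-skip : ∀ y p → All (λ x → ¬ (parity y ≡ 0ℙ × suc x ≡ y)) p → remʳ (y ∷ p) ≡ remʳ p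
remʳ-skip y []      _        = refl
remʳ-skip y (x ∷ p) (¬pair ∷ _)
  rewrite dec-false (removable? (2 + length p) (length (remʳ p)) x y)
            (λ (ev , adj , _) → ¬pair (ev , adj)) = refl

remʳ-take : ∀ x p → parity x ≡ 1ℙ → suc x < 2 * (2 + length p) ∸ length (remʳ p) ∸ 1 →
            remʳ (suc x ∷ x ∷ p) ≡ suc x ∷ x ∷ remʳ p
remʳ-take x p px lt
  rewrite dec-true (removable? (2 + length p) (length (remʳ p)) x (suc x)) (parity-suc-odd x px , refl , lt) = refl

remʳ-leave : ∀ x y p → ¬ (y < 2 * (2 + length p) ∸ length (remʳ p) ∸ 1) →
             remʳ (y ∷ x ∷ p) ≡ remʳ (x ∷ p)
remʳ-leave x y p ≮
  rewrite dec-false (removable? (2 + length p) (length (remʳ p)) x y) (λ (_ , _ , lt) → ≮ lt) = refl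

remʳ-skip-odd : ∀ b p → parity b ≡ 0ℙ → remʳ (suc b ∷ p) ≡ remʳ p
remʳ-skip-odd b p pb = remʳ-skip (suc b) p (All.universal (λ _ (ev , _) → 0≢1 (trans (sym ev) (parity-suc-even b pb))) p)
  where
  0≢1 : 0ℙ ≢ 1ℙ
  0≢1 ()

-- Under the scanning invariant the removal bound for the pair `1 + b`, `2 + b` becomes
-- `3 + b - 2d`, so the pair goes only when `d` is zero. Adding `2d` to both terms of the truncated
-- difference makes the invariant applicable.
threshold : ∀ l d b r → (l + l) + (d + d) ≡ b + r →
            2 * (2 + l) ∸ r ∸ 1 ≡ 3 + b ∸ (d + d)
threshold l d b r inv = begin
  2 * (2 + l) ∸ r ∸ 1                   ≡⟨ ℕ.∸-+-assoc (2 * (2 + l)) r 1 ⟩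
  2 * (2 + l) ∸ (r + 1)                 ≡⟨ ℕ.[m+n]∸[m+o]≡n∸o (d + d) (2 * (2 + l)) (r + 1) ⟨
  (d + d) + 2 * (2 + l) ∸ ((d + d) + (r + 1)) ≡⟨ cong₂ _∸_ lhs rhs ⟩
  (r + 1) + (3 + b) ∸ ((r + 1) + (d + d)) ≡⟨ ℕ.[m+n]∸[m+o]≡n∸o (r + 1) (3 + b) (d + d) ⟩
  3 + b ∸ (d + d)                       ∎
  where
  open ≡-Reasoning
  arrange : ∀ l d → (d + d) + 2 * (2 + l) ≡ 4 + ((l + l) + (d + d))
  arrange = ℕ-Solver.solve-∀
  arrange′ : ∀ b r → 4 + (b + r) ≡ (r + 1) + (3 + b)
  arrange′ = ℕ-Solver.solve-∀
  lhs : (d + d) + 2 * (2 + l) ≡ (r + 1) + (3 + b)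
  lhs = trans (arrange l d) (trans (cong (_+_ 4) inv) (arrange′ b r))
  rhs : (d + d) + (r + 1) ≡ (r + 1) + (d + d)
  rhs = ℕ.+-comm (d + d) (r + 1)

-- Here `p` is the prefix already scanned, last entry first, the form on which `remʳ` recurses. Each
-- slot raises both sides of the invariant by 2, except that a removed pair raises both by 4: two
-- more entries on the left, two more removed ones on the right.
remʳ-decode : ∀ b d cs p → parity b ≡ 0ℙ → All (_≤ b) p →
              (length p + length p) + (d + d) ≡ b + length (remʳ p) →
              remʳ (decode b cs ʳ++ p) ≡ removed b d cs ʳ++ remʳ p
remʳ-decode b d []          p pb p≤b inv = refl
remʳ-decode b d (none ∷ cs) p pb p≤b inv =
  remʳ-decode (2 + b) (suc d) cs p pb (All.map (ℕ.m≤n⇒m≤o+n 2) p≤b)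
    (trans (arrange (length p) d) (cong (_+_ 2) inv))
  where
  arrange : ∀ l d → (l + l) + (suc d + suc d) ≡ 2 + ((l + l) + (d + d))
  arrange = ℕ-Solver.solve-∀
remʳ-decode b d (odd ∷ cs) p pb p≤b inv =
  trans (remʳ-decode (2 + b) d cs (suc b ∷ p) pb (ℕ.n≤1+n _ ∷ All.map (ℕ.m≤n⇒m≤o+n 2) p≤b)
          (trans (arrange (length p) d) (cong (_+_ 2) (trans inv (cong (λ r → b + length r) (sym skip))))))
        (cong (removed (2 + b) d cs ʳ++_) skip)
  where
  skip = remʳ-skip-odd b p pb
  arrange : ∀ l d → (suc l + suc l) + (d + d) ≡ 2 + ((l + l) + (d + d))
  arrange = ℕ-Solver.solve-∀
remʳ-decode b d (even ∷ cs) p pb p≤b inv =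
  trans (remʳ-decode (2 + b) d cs (2 + b ∷ p) pb (ℕ.≤-refl ∷ All.map (ℕ.m≤n⇒m≤o+n 2) p≤b)
          (trans (arrange (length p) d) (cong (_+_ 2) (trans inv (cong (λ r → b + length r) (sym skip))))))
        (cong (removed (2 + b) d cs ʳ++_) skip)
  where
  -- The partner `1 + b` of `2 + b` exceeds every entry of `p`, so it is absent.
  skip = remʳ-skip (2 + b) p (All.map (λ x≤b (_ , adj) → ℕ.<-irrefl adj (s≤s (s≤s x≤b))) p≤b)
  arrange : ∀ l d → (suc l + suc l) + (d + d) ≡ 2 + ((l + l) + (d + d))
  arrange = ℕ-Solver.solve-∀
remʳ-decode b zero (full ∷ cs) p pb p≤b inv =
  trans (remʳ-decode (2 + b) 0 cs (2 + b ∷ suc b ∷ p) pb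
          (ℕ.≤-refl ∷ ℕ.n≤1+n _ ∷ All.map (ℕ.m≤n⇒m≤o+n 2) p≤b)
          (trans (arrange (length p)) (trans (cong (_+_ 4) inv)
            (trans (arrange′ b (length (remʳ p))) (cong (λ r → 2 + b + length r) (sym both))))))
        (cong (removed (2 + b) 0 cs ʳ++_) both)
  where
  -- With the counter at zero the threshold is exactly `3 + b`, one above the even entry.
  both = remʳ-take (suc b) p (parity-suc-even b pb)
           (ℕ.≤-reflexive (sym (threshold (length p) 0 b (length (remʳ p)) inv)))
  arrange : ∀ l → (2 + l + (2 + l)) + 0 ≡ 4 + ((l + l) + 0)
  arrange = ℕ-Solver.solve-∀
  arrange′ : ∀ b r → 4 + (b + r) ≡ 2 + b + (2 + r)
  arrange′ = ℕ-Solver.solve-∀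
remʳ-decode b (suc d) (full ∷ cs) p pb p≤b inv =
  trans (remʳ-decode (2 + b) d cs (2 + b ∷ suc b ∷ p) pb
          (ℕ.≤-refl ∷ ℕ.n≤1+n _ ∷ All.map (ℕ.m≤n⇒m≤o+n 2) p≤b)
          (trans (arrange (length p) d)
            (cong (_+_ 2) (trans inv (cong (λ r → b + length r) (sym neither))))))
        (cong (removed (2 + b) d cs ʳ++_) neither)
  where
  -- A positive counter lowers the threshold, so that it no longer exceeds the even entry `2 + b`.
  ≮ : ¬ (2 + b < 2 * (2 + length p) ∸ length (remʳ p) ∸ 1)
  ≮ lt = ℕ.<⇒≱ lt (ℕ.≤-trans (ℕ.≤-reflexive (threshold (length p) (suc d) b (length (remʳ p)) inv))
                              (ℕ.m∸n≤m (2 + b) (d + suc d)))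
  neither = trans (remʳ-leave (suc b) (2 + b) p ≮) (remʳ-skip-odd b p pb)
  arrange : ∀ l d → (2 + l + (2 + l)) + (d + d) ≡ 2 + ((l + l) + (suc d + suc d))
  arrange = ℕ-Solver.solve-∀

rem-decode : ∀ cs → rem (decode 0 cs) ≡ removed 0 0 cs
rem-decode cs = trans (cong reverse (remʳ-decode 0 0 cs [] refl [] refl)) (List.reverse-involutive _)

removed-> : ∀ b d cs → All (b <_) (removed b d cs)
removed->-suc² : ∀ b d cs → All (b <_) (removed (2 + b) d cs)

removed-> b d       []          = []
removed-> b d       (none ∷ cs) = removed->-suc² b (suc d) cs
removed-> b d       (odd  ∷ cs) = removed->-suc² b d cs
removed-> b d       (even ∷ cs) = removed->-suc² b d cs
removed-> b zero    (full ∷ cs) = ℕ.≤-refl ∷ ℕ.n≤1+n _ ∷ removed->-suc² b zero cs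
removed-> b (suc d) (full ∷ cs) = removed->-suc² b d cs

removed->-suc² b d cs = All.map (ℕ.<-trans (ℕ.m<n⇒m<1+n ℕ.≤-refl)) (removed-> (2 + b) d cs)

removed-∌ : ∀ {x b} d cs → x ≤ b → x ∉ removed b d cs
removed-∌ {b = b} d cs x≤b x∈ = ℕ.<⇒≱ (All.lookup (removed-> b d cs) x∈) x≤b

_∖_ : List ℕ → List ℕ → List ℕ
xs ∖ R = filter (λ x → ¬? (x ∈? R)) xs

∖-keep : ∀ {x R} xs → x ∉ R → (x ∷ xs) ∖ R ≡ x ∷ (xs ∖ R)
∖-keep {R = R} xs = List.filter-accept (λ x → ¬? (x ∈? R))

∖-drop : ∀ {x R} xs → x ∈ R → (x ∷ xs) ∖ R ≡ xs ∖ R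
∖-drop {R = R} xs x∈R = List.filter-reject (λ x → ¬? (x ∈? R)) (λ x∉R → x∉R x∈R)

-- Lets the removal list shrink along with the scan.
∖-∷-below : ∀ {x R xs} → All (x <_) xs → xs ∖ (x ∷ R) ≡ xs ∖ R
∖-∷-below []                               = refl
∖-∷-below {x} {R} {y ∷ ys} (x<y ∷ xs>) = go (y ∈? R)
  where
  y∉x∷R : y ∉ R → y ∉ x ∷ R
  y∉x∷R y∉R (here y≡x)  = ℕ.<-irrefl (sym y≡x) x<y
  y∉x∷R y∉R (there y∈R) = y∉R y∈R
  go : Dec (y ∈ R) → (y ∷ ys) ∖ (x ∷ R) ≡ (y ∷ ys) ∖ R
  go (yes y∈R) = trans (∖-drop ys (there y∈R)) (trans (∖-∷-below xs>) (sym (∖-drop ys y∈R)))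
  go (no  y∉R) = trans (∖-keep ys (y∉x∷R y∉R)) (trans (cong (y ∷_) (∖-∷-below xs>)) (sym (∖-keep ys y∉R)))

-- Entries removed from later slots are larger than both values of the current slot, so each slot is
-- decided on its own.
decode-∖-removed : ∀ b d cs → decode b cs ∖ removed b d cs ≡ decode b (reduce d cs)
decode-∖-removed b d []          = refl
decode-∖-removed b d (none ∷ cs) = decode-∖-removed (2 + b) (suc d) cs
decode-∖-removed b d (odd  ∷ cs) =
  trans (∖-keep _ (removed-∌ d cs (ℕ.n≤1+n _)))
        (cong (suc b ∷_) (decode-∖-removed (2 + b) d cs))
decode-∖-removed b d (even ∷ cs) =
  trans (∖-keep _ (removed-∌ d cs ℕ.≤-refl))
        (cong (2 + b ∷_) (decode-∖-removed (2 + b) d cs))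
decode-∖-removed b zero (full ∷ cs) = begin
  (suc b ∷ 2 + b ∷ D) ∖ (suc b ∷ 2 + b ∷ R) ≡⟨ ∖-drop {R = suc b ∷ 2 + b ∷ R} (2 + b ∷ D) (here refl) ⟩
  (2 + b ∷ D) ∖ (suc b ∷ 2 + b ∷ R)         ≡⟨ ∖-drop {R = suc b ∷ 2 + b ∷ R} D (there (here refl)) ⟩
  D ∖ (suc b ∷ 2 + b ∷ R)                   ≡⟨ ∖-∷-below (All.map ℕ.<⇒≤ D>) ⟩
  D ∖ (2 + b ∷ R)                           ≡⟨ ∖-∷-below D> ⟩
  D ∖ R                                     ≡⟨ decode-∖-removed (2 + b) zero cs ⟩
  decode (2 + b) (reduce zero cs)           ∎
  where
  open ≡-Reasoning
  D = decode (2 + b) cs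
  R = removed (2 + b) zero cs
  D> = decode-> (2 + b) cs
decode-∖-removed b (suc d) (full ∷ cs) =
  trans (∖-keep _ (removed-∌ d cs (ℕ.n≤1+n _)))
        (cong (suc b ∷_)
          (trans (∖-keep _ (removed-∌ d cs ℕ.≤-refl))
                 (cong (2 + b ∷_) (decode-∖-removed (2 + b) d cs))))

red-decode : ∀ cs → red (decode 0 cs) ≡ decode 0 (reduce 0 cs)
red-decode cs = trans (cong (decode 0 cs ∖_) (rem-decode cs)) (decode-∖-removed 0 0 cs)

-- Filling empty slots inverts the reduction

fill-zero : ∀ cs → fill 0 cs ≡ cs
fill-zero []          = refl
fill-zero (none ∷ cs) = cong (none ∷_) (fill-zero cs)
fill-zero (odd  ∷ cs) = cong (odd ∷_) (fill-zero cs)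
fill-zero (even ∷ cs) = cong (even ∷_) (fill-zero cs)
fill-zero (full ∷ cs) = cong (full ∷_) (fill-zero cs)

reduce-NoFull : ∀ d {cs} → NoFull cs → reduce d cs ≡ cs
reduce-NoFull d {[]}        []        = refl
reduce-NoFull d {none ∷ cs} (_ ∷ nf)  = cong (none ∷_) (reduce-NoFull (suc d) nf)
reduce-NoFull d {odd  ∷ cs} (_ ∷ nf)  = cong (odd ∷_) (reduce-NoFull d nf)
reduce-NoFull d {even ∷ cs} (_ ∷ nf)  = cong (even ∷_) (reduce-NoFull d nf)
reduce-NoFull d {full ∷ cs} (f≢f ∷ _) = contradiction refl f≢f

-- The filled slots precede every empty slot left over, so the counter is still zero at each of them
-- and each is emptied again; from the first leftover empty slot on, nothing is full.
reduce-fill : ∀ k {cs} → NoFull cs → reduce 0 (fill k cs) ≡ cs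
reduce-fill k       {[]}        []        = refl
reduce-fill zero    {none ∷ cs} (_ ∷ nf)
  rewrite fill-zero cs                    = cong (none ∷_) (reduce-NoFull 1 nf)
reduce-fill (suc k) {none ∷ cs} (_ ∷ nf)  = cong (none ∷_) (reduce-fill k nf)
reduce-fill k       {odd  ∷ cs} (_ ∷ nf)  = cong (odd ∷_) (reduce-fill k nf)
reduce-fill k       {even ∷ cs} (_ ∷ nf)  = cong (even ∷_) (reduce-fill k nf)
reduce-fill k       {full ∷ cs} (f≢f ∷ _) = contradiction refl f≢f

-- A positive counter keeps the next full slot, so a result without full slots means that `cs` had
-- none and nothing changed.
NoFull-reduce-suc : ∀ d cs → NoFull (reduce (suc d) cs) → reduce (suc d) cs ≡ cs
NoFull-reduce-suc d []          _         = refl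
NoFull-reduce-suc d (none ∷ cs) (_ ∷ nf)  = cong (none ∷_) (NoFull-reduce-suc (suc d) cs nf)
NoFull-reduce-suc d (odd  ∷ cs) (_ ∷ nf)  = cong (odd ∷_) (NoFull-reduce-suc d cs nf)
NoFull-reduce-suc d (even ∷ cs) (_ ∷ nf)  = cong (even ∷_) (NoFull-reduce-suc d cs nf)
NoFull-reduce-suc d (full ∷ cs) (f≢f ∷ _) = contradiction refl f≢f

-- The witness `k` counts the full slots. They all precede the first empty slot, because the first
-- full slot after it would survive the reduction.
NoFull-reduce⇒fill : ∀ cs → NoFull (reduce 0 cs) →
                     ∃[ k ] k ≤ empties (reduce 0 cs) × cs ≡ fill k (reduce 0 cs)
NoFull-reduce⇒fill []          _        = 0 , z≤n , refl
NoFull-reduce⇒fill (none ∷ cs) (_ ∷ nf) =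
  0 , z≤n , cong (none ∷_) (trans (sym (NoFull-reduce-suc 0 cs nf)) (sym (fill-zero _)))
NoFull-reduce⇒fill (odd ∷ cs)  (_ ∷ nf) with NoFull-reduce⇒fill cs nf
... | k , k≤ , eq = k , k≤ , cong (odd ∷_) eq
NoFull-reduce⇒fill (even ∷ cs) (_ ∷ nf) with NoFull-reduce⇒fill cs nf
... | k , k≤ , eq = k , k≤ , cong (even ∷_) eq
NoFull-reduce⇒fill (full ∷ cs) (_ ∷ nf) with NoFull-reduce⇒fill cs nf
... | k , k≤ , eq = suc k , s≤s k≤ , cong (full ∷_) eq

length-fill : ∀ k cs → length (fill k cs) ≡ length cs
length-fill k       []          = refl
length-fill zero    (none ∷ cs) = cong suc (length-fill zero cs)
length-fill (suc k) (none ∷ cs) = cong suc (length-fill k cs)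
length-fill k       (odd  ∷ cs) = cong suc (length-fill k cs)
length-fill k       (even ∷ cs) = cong suc (length-fill k cs)
length-fill k       (full ∷ cs) = cong suc (length-fill k cs)

length-decode-NoFull : ∀ b {cs} → NoFull cs → length (decode b cs) + empties cs ≡ length cs
length-decode-NoFull b {[]}        []        = refl
length-decode-NoFull b {none ∷ cs} (_ ∷ nf)  =
  trans (ℕ.+-suc _ _) (cong suc (length-decode-NoFull (2 + b) nf))
length-decode-NoFull b {odd  ∷ cs} (_ ∷ nf)  = cong suc (length-decode-NoFull (2 + b) nf)
length-decode-NoFull b {even ∷ cs} (_ ∷ nf)  = cong suc (length-decode-NoFull (2 + b) nf)
length-decode-NoFull b {full ∷ cs} (f≢f ∷ _) = contradiction refl f≢f

length-decode-fill : ∀ b k cs → k ≤ empties cs →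
                     length (decode b (fill k cs)) ≡ k * 2 + length (decode b cs)
length-decode-fill b zero    cs          _        = cong (length ∘ decode b) (fill-zero cs)
length-decode-fill b (suc k) (none ∷ cs) (s≤s k≤) = cong (_+_ 2) (length-decode-fill (2 + b) k cs k≤)
length-decode-fill b (suc k) (odd  ∷ cs) k≤       =
  trans (cong suc (length-decode-fill (2 + b) (suc k) cs k≤)) (sym (ℕ.+-suc (suc k * 2) _))
length-decode-fill b (suc k) (even ∷ cs) k≤       =
  trans (cong suc (length-decode-fill (2 + b) (suc k) cs k≤)) (sym (ℕ.+-suc (suc k * 2) _))
length-decode-fill b (suc k) (full ∷ cs) k≤       =
  trans (cong (_+_ 2) (length-decode-fill (2 + b) (suc k) cs k≤))
        (sym (trans (ℕ.+-suc (suc k * 2) _) (cong suc (ℕ.+-suc (suc k * 2) _))))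

-- Run lengths

-- The even number ending the pair that contains `a`; the run following `a` starts just above it.
after : ℕ → ℕ
after a with parity a
... | 0ℙ = a
... | 1ℙ = a + 1

runAfter≡run : ∀ a k → runAfter a k ≡ run (after a) k
runAfter≡run a k with parity a
... | 0ℙ = refl
... | 1ℙ = refl

-- The four parity cases share one meaning: `firstGap a′` is the even number just below the pair of
-- `a′`, so for `a` in an earlier pair the difference counts the values strictly between the two
-- pairs.
gap≡ : ∀ a a′ → gap a a′ ≡ firstGap a′ ℤ.- + after a
gap≡ a a′ with parity a | parity a′
... | 0ℙ | 0ℙ = swap (+ a) (+ a′)
  where
  swap : ∀ x y → y ℤ.- x ℤ.- + 2 ≡ y ℤ.- + 2 ℤ.- x
  swap = ℤ-Solver.solve-∀
... | 1ℙ | 1ℙ = swap (+ a) (+ a′)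
  where
  swap : ∀ x y → y ℤ.- x ℤ.- + 2 ≡ y ℤ.- + 1 ℤ.- (x ℤ.+ + 1)
  swap = ℤ-Solver.solve-∀
... | 0ℙ | 1ℙ = swap (+ a) (+ a′)
  where
  swap : ∀ x y → y ℤ.- x ℤ.- + 1 ≡ y ℤ.- + 1 ℤ.- x
  swap = ℤ-Solver.solve-∀
... | 1ℙ | 0ℙ = swap (+ a) (+ a′)
  where
  swap : ∀ x y → y ℤ.- x ℤ.- + 3 ≡ y ℤ.- + 2 ℤ.- (x ℤ.+ + 1)
  swap = ℤ-Solver.solve-∀

-- K is what remains of l - t, and the next run starts at b + 1.
lengths : ℤ → ℕ → List ℕ → List ℤ
lengths K b []       = K ∷ []
lengths K b (a ∷ as) = g ∷ lengths (K ℤ.- g) (after a) as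
  where
  g : ℤ
  g = (firstGap a ℤ.- + b) ℤ.⊓ K

laterLengths≡ : ∀ l t σ aᵢ as → laterLengths l t σ aᵢ as ≡ lengths (+ l ℤ.- + t ℤ.- σ) (after aᵢ) as
laterLengths≡ l t σ aᵢ []       = refl
laterLengths≡ l t σ aᵢ (a ∷ as) rewrite gap≡ aᵢ a =
  cong (g ∷_) (trans (laterLengths≡ l t (σ ℤ.+ g) a as)
                     (cong (λ K → lengths K (after a) as) (assoc (+ l ℤ.- + t) σ g)))
  where
  g = (firstGap a ℤ.- + after aᵢ) ℤ.⊓ (+ l ℤ.- + t ℤ.- σ)
  assoc : ∀ x y z → x ℤ.- (y ℤ.+ z) ≡ x ℤ.- y ℤ.- z
  assoc = ℤ-Solver.solve-∀

runLengths≡ : ∀ l t a → runLengths l t a ≡ lengths (+ l ℤ.- + t) 0 a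
runLengths≡ l t []       = refl
runLengths≡ l t (a ∷ as) rewrite ℤ.+-identityʳ (firstGap a) =
  cong (_ ∷_) (laterLengths≡ l t (firstGap a ℤ.⊓ (+ l ℤ.- + t)) a as)

-- When k empty slots are filled, firstBlock is the number of pairs in T_0 and
-- laterBlocks lists the numbers of pairs in T_1, …, T_t.
firstBlock : ℕ → List Slot → ℕ
firstBlock k       []          = k
firstBlock k       (odd  ∷ cs) = 0
firstBlock k       (even ∷ cs) = 0
firstBlock k       (full ∷ cs) = 0
firstBlock zero    (none ∷ cs) = 0
firstBlock (suc k) (none ∷ cs) = suc (firstBlock k cs)

laterBlocks : ℕ → List Slot → List ℕ
laterBlocks k []          = []
laterBlocks k (none ∷ cs) = laterBlocks (pred k) cs
laterBlocks k (odd  ∷ cs) = firstBlock k cs ∷ laterBlocks k cs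
laterBlocks k (even ∷ cs) = firstBlock k cs ∷ laterBlocks k cs
laterBlocks k (full ∷ cs) = []

firstBlock-zero : ∀ cs → firstBlock 0 cs ≡ 0
firstBlock-zero []          = refl
firstBlock-zero (none ∷ cs) = refl
firstBlock-zero (odd  ∷ cs) = refl
firstBlock-zero (even ∷ cs) = refl
firstBlock-zero (full ∷ cs) = refl

double : ℕ → ℤ
double k = + (k * 2)

firstGap-odd : ∀ b → parity b ≡ 0ℙ → firstGap (suc b) ≡ + b
firstGap-odd b p rewrite parity-suc-even b p = refl

firstGap-even : ∀ b → parity b ≡ 0ℙ → firstGap (2 + b) ≡ + b
firstGap-even b p rewrite p = refl

after-odd : ∀ b → parity b ≡ 0ℙ → after (suc b) ≡ 2 + b
after-odd b p rewrite parity-suc-even b p = cong suc (ℕ.+-comm b 1)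

after-even : ∀ b → parity b ≡ 0ℙ → after (2 + b) ≡ 2 + b
after-even b p rewrite p = refl

-- The next entry lies in the slot starting at `c`, so the gap is zero and the remainder is passed
-- on intact.
lengths-no-gap : ∀ k b c a as → firstGap a ≡ + b → after a ≡ 2 + b → + b ℤ.- + c ≡ 0ℤ →
                 lengths (double k) c (a ∷ as) ≡ 0ℤ ∷ lengths (double k) (2 + b) as
lengths-no-gap k b c a as fg aft diff rewrite fg | aft | diff | ℤ.+-identityʳ (double k) = refl

lengths-exhausted : ∀ b c a as → firstGap a ≡ + b → after a ≡ 2 + b → c ≤ b →
                    lengths 0ℤ c (a ∷ as) ≡ 0ℤ ∷ lengths 0ℤ (2 + b) as
lengths-exhausted b c a as fg aft c≤b
  rewrite fg | aft | ℤ.i≥j⇒i⊓j≡j (ℤ.i≤j⇒0≤j-i (ℤ.+≤+ c≤b)) = refl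

-- One pair is put at the front of the run. Starting two values earlier with two more to place
-- lengthens this run by two, since adding 2 commutes with the minimum; the remainder passed on is
-- the same, so the later lengths agree.
lengths-shift : ∀ K b as {h hs} → lengths K (2 + b) as ≡ h ∷ hs →
                lengths (+ 2 ℤ.+ K) b as ≡ (+ 2 ℤ.+ h) ∷ hs
lengths-shift K b []       refl = refl
lengths-shift K b (a ∷ as) refl =
  cong₂ _∷_ head≡ (cong (λ K′ → lengths K′ (after a) as)
    (trans (cong (λ u → + 2 ℤ.+ K ℤ.- u) head≡) (cancel K ((firstGap a ℤ.- + (2 + b)) ℤ.⊓ K))))
  where
  cancel : ∀ x y → + 2 ℤ.+ x ℤ.- (+ 2 ℤ.+ y) ≡ x ℤ.- y
  cancel = ℤ-Solver.solve-∀
  absorb : ∀ x y → x ℤ.- y ≡ + 2 ℤ.+ (x ℤ.- (+ 2 ℤ.+ y))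
  absorb = ℤ-Solver.solve-∀
  head≡ : (firstGap a ℤ.- + b) ℤ.⊓ (+ 2 ℤ.+ K) ≡ + 2 ℤ.+ ((firstGap a ℤ.- + (2 + b)) ℤ.⊓ K)
  head≡ = trans (cong (ℤ._⊓ (+ 2 ℤ.+ K)) (absorb (firstGap a) (+ b)))
                (sym (ℤ.mono-≤-distrib-⊓ (ℤ.+-monoʳ-≤ (+ 2)) (firstGap a ℤ.- + (2 + b)) K))

-- Two positions are tracked: `b` is the scan, and `c` is where the next run would start, which
-- stays behind while empty slots are passed over unfilled.
lengths-zero : ∀ c b {cs} → NoFull cs → parity b ≡ 0ℙ → c ≤ b →
               lengths 0ℤ c (decode b cs) ≡ 0ℤ ∷ map double (laterBlocks 0 cs)
lengths-zero c b {[]}        _         p c≤b = refl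
lengths-zero c b {none ∷ cs} (_ ∷ nf)  p c≤b = lengths-zero c (2 + b) nf p (ℕ.m≤n⇒m≤o+n 2 c≤b)
lengths-zero c b {odd  ∷ cs} (_ ∷ nf)  p c≤b
  rewrite lengths-exhausted b c (suc b) (decode (2 + b) cs) (firstGap-odd b p) (after-odd b p) c≤b
        | firstBlock-zero cs = cong (0ℤ ∷_) (lengths-zero (2 + b) (2 + b) nf p ℕ.≤-refl)
lengths-zero c b {even ∷ cs} (_ ∷ nf)  p c≤b
  rewrite lengths-exhausted b c (2 + b) (decode (2 + b) cs) (firstGap-even b p) (after-even b p) c≤b
        | firstBlock-zero cs = cong (0ℤ ∷_) (lengths-zero (2 + b) (2 + b) nf p ℕ.≤-refl)
lengths-zero c b {full ∷ cs} (f≢f ∷ _) p c≤b = contradiction refl f≢f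

lengths-decode : ∀ k b {cs} → NoFull cs → parity b ≡ 0ℙ →
                 lengths (double k) b (decode b cs) ≡ map double (firstBlock k cs ∷ laterBlocks k cs)
lengths-decode k       b {[]}        _         p = refl
-- With nothing left to place, the scan moves on but the start of the run stays at `b`.
lengths-decode zero    b {none ∷ cs} nf        p = lengths-zero b b nf p ℕ.≤-refl
lengths-decode (suc k) b {none ∷ cs} (_ ∷ nf)  p =
  lengths-shift (double k) b (decode (2 + b) cs) (lengths-decode k (2 + b) nf p)
lengths-decode k       b {odd  ∷ cs} (_ ∷ nf)  p =
  trans (lengths-no-gap k b b (suc b) _ (firstGap-odd b p) (after-odd b p) (ℤ.+-inverseʳ (+ b)))
        (cong (0ℤ ∷_) (lengths-decode k (2 + b) nf p))
lengths-decode k       b {even ∷ cs} (_ ∷ nf)  p =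
  trans (lengths-no-gap k b b (2 + b) _ (firstGap-even b p) (after-even b p) (ℤ.+-inverseʳ (+ b)))
        (cong (0ℤ ∷_) (lengths-decode k (2 + b) nf p))
lengths-decode k       b {full ∷ cs} (f≢f ∷ _) p = contradiction refl f≢f

runLengths-decode : ∀ k t {cs} → NoFull cs →
  runLengths (k * 2 + t) t (decode 0 cs) ≡ map double (firstBlock k cs ∷ laterBlocks k cs)
runLengths-decode k t {cs} nf = begin
  runLengths (k * 2 + t) t (decode 0 cs)          ≡⟨ runLengths≡ (k * 2 + t) t (decode 0 cs) ⟩
  lengths (double k ℤ.+ + t ℤ.- + t) 0 (decode 0 cs)
    ≡⟨ cong (λ K → lengths K 0 (decode 0 cs)) (cancel (double k) (+ t)) ⟩
  lengths (double k) 0 (decode 0 cs)              ≡⟨ lengths-decode k 0 nf refl ⟩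
  map double (firstBlock k cs ∷ laterBlocks k cs) ∎
  where
  open ≡-Reasoning
  cancel : ∀ x y → x ℤ.+ y ℤ.- y ≡ x
  cancel = ℤ-Solver.solve-∀

-- Concatenating the runs

applyUpTo-cong : ∀ {f g : ℕ → ℕ} → (∀ i → f i ≡ g i) → ∀ n → applyUpTo f n ≡ applyUpTo g n
applyUpTo-cong f≗g zero    = refl
applyUpTo-cong f≗g (suc n) = cong₂ _∷_ (f≗g 0) (applyUpTo-cong (f≗g ∘ suc) n)

run-suc : ∀ c k → run c (+ suc k) ≡ suc c ∷ run (suc c) (+ k)
run-suc c k = cong₂ _∷_ (ℕ.+-comm c 1) (applyUpTo-cong (λ j → ℕ.+-suc c (suc j)) k)

tails : List ℕ → List ℤ → List ℕ
tails as ks = concat (zipWith (λ a k → a ∷ runAfter a k) as ks)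

-- The bound on `k` matters at the end of the list: `firstBlock` gives the whole remainder to the
-- last run, `fill` discards it, and the bound makes it zero.
run-tails-decode : ∀ k b {cs} → NoFull cs → parity b ≡ 0ℙ → k ≤ empties cs →
  run b (double (firstBlock k cs)) ++ tails (decode b cs) (map double (laterBlocks k cs))
  ≡ decode b (fill k cs)
run-tails-decode zero    b {[]}        _        p k≤ = refl
run-tails-decode zero    b {none ∷ cs} (_ ∷ nf) p k≤ =
  -- A run of length zero is empty from any base, so its base may move past the unfilled slot.
  trans (cong (λ h → run (2 + b) (double h) ++ tails (decode (2 + b) cs) (map double (laterBlocks 0 cs)))
          (sym (firstBlock-zero cs)))
        (run-tails-decode zero (2 + b) nf p z≤n)
run-tails-decode (suc k) b {none ∷ cs} (_ ∷ nf) p (s≤s k≤) =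
  trans (cong (_++ tails (decode (2 + b) cs) (map double (laterBlocks k cs)))
          (trans (run-suc b _) (cong (suc b ∷_) (run-suc (suc b) _))))
        (cong (λ xs → suc b ∷ 2 + b ∷ xs) (run-tails-decode k (2 + b) nf p k≤))
run-tails-decode k b {odd ∷ cs} (_ ∷ nf) p k≤
  rewrite runAfter≡run (suc b) (double (firstBlock k cs)) | after-odd b p =
  cong (suc b ∷_) (run-tails-decode k (2 + b) nf p k≤)
run-tails-decode k b {even ∷ cs} (_ ∷ nf) p k≤
  rewrite runAfter≡run (2 + b) (double (firstBlock k cs)) | after-even b p =
  cong (2 + b ∷_) (run-tails-decode k (2 + b) nf p k≤)
run-tails-decode k b {full ∷ cs} (f≢f ∷ _) p k≤ = contradiction refl f≢f

preimage-decode : ∀ k t {cs} → NoFull cs → k ≤ empties cs →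
                  preimage (k * 2 + t) t (decode 0 cs) ≡ decode 0 (fill k cs)
preimage-decode k t {cs} nf k≤ =
  trans (cong (λ ks → assemble ks (decode 0 cs)) (runLengths-decode k t nf))
        (run-tails-decode k 0 nf refl k≤)

-- Existence and uniqueness of the preimage

enough-empties : ∀ k t {n cs} → NoFull cs → length cs ≡ n → length (decode 0 cs) ≡ t →
                 k * 2 + t ≤ 2 * n → t ≤ 2 * n ∸ (k * 2 + t) → k ≤ empties cs
-- Without full slots each entry occupies its own slot, so `t` and the empty slots add up to `n`,
-- while `t ≤ 2n - l` with `l = 2k + t` gives `t + k ≤ n`.
enough-empties k t {cs = cs} nf refl refl l≤2n t≤ = ℕ.+-cancelˡ-≤ t k (empties cs) (begin
  t + k          ≤⟨ ℕ.*-cancelˡ-≤ 2 2[t+k]≤2n ⟩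
  length cs      ≡⟨ length-decode-NoFull 0 nf ⟨
  t + empties cs ∎)
  where
  open ℕ.≤-Reasoning
  arrange : ∀ t k → 2 * (t + k) ≡ t + (k * 2 + t)
  arrange = ℕ-Solver.solve-∀
  2[t+k]≤2n : 2 * (t + k) ≤ 2 * length cs
  2[t+k]≤2n = begin
    2 * (t + k)                                       ≡⟨ arrange t k ⟩
    t + (k * 2 + t)                                   ≤⟨ ℕ.+-monoˡ-≤ (k * 2 + t) t≤ ⟩
    2 * length cs ∸ (k * 2 + t) + (k * 2 + t)         ≡⟨ ℕ.m∸n+n≡m l≤2n ⟩
    2 * length cs                                     ∎

fill-IsPreimage : ∀ k t {n cs} → NoFull cs → k ≤ empties cs →
                  length cs ≡ n → length (decode 0 cs) ≡ t →
                  IsPreimage n (k * 2 + t) (decode 0 cs) (decode 0 (fill k cs))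
fill-IsPreimage k t {cs = cs} nf k≤ refl refl = sst , red≡
  where
  sst : IsSST (length cs) (k * 2 + t) (decode 0 (fill k cs))
  sst = subst (λ m → IsSST m (k * 2 + t) (decode 0 (fill k cs))) (length-fill k cs)
          (subst (λ l → IsSST (length (fill k cs)) l (decode 0 (fill k cs)))
            (length-decode-fill 0 k cs k≤) (decode-SST (fill k cs)))
  red≡ = trans (red-decode (fill k cs)) (cong (decode 0) (reduce-fill k nf))

preimage-unique : ∀ k t {n a T} → length a ≡ t → (∀ x → x ∈ a → 𝐬 x ∉ a) →
                  IsPreimage n (k * 2 + t) a T → T ≡ preimage (k * 2 + t) t a
preimage-unique k t lenₐ free (sst , refl) with encode-SST sst
... | γ , _ , refl
  -- The condition on `a` is transported to the reduced slots, where it excludes full ones.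
  with nf ← 𝐬-free⇒NoFull 0 (reduce 0 γ) refl
              (subst (λ a → ∀ x → x ∈ a → 𝐬 x ∉ a) (red-decode γ) free)
  with j , j≤ , γ≡fill ← NoFull-reduce⇒fill γ nf = begin
  decode 0 γ                                   ≡⟨ cong (decode 0) γ≡fill ⟩
  decode 0 (fill j (reduce 0 γ))               ≡⟨ preimage-decode j t nf j≤ ⟨
  preimage (j * 2 + t) t (decode 0 (reduce 0 γ)) ≡⟨ cong₂ (λ l a → preimage l t a) l≡ (red-decode γ) ⟨
  preimage (k * 2 + t) t (red (decode 0 γ))    ∎
  where
  open ≡-Reasoning
  -- The length of the column ties the number `j` of filled slots to the prescribed `k`.
  l≡ : k * 2 + t ≡ j * 2 + t
  l≡ = begin
    k * 2 + t                               ≡⟨ IsSST.length≡ sst ⟨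
    length (decode 0 γ)                     ≡⟨ cong (length ∘ decode 0) γ≡fill ⟩
    length (decode 0 (fill j (reduce 0 γ))) ≡⟨ length-decode-fill 0 j (reduce 0 γ) j≤ ⟩
    j * 2 + length (decode 0 (reduce 0 γ))  ≡⟨ cong (λ a → j * 2 + length a) (red-decode γ) ⟨
    j * 2 + length (red (decode 0 γ))       ≡⟨ cong (_+_ (j * 2)) lenₐ ⟩
    j * 2 + t                               ∎

theorem2 : ∀ (n l t : ℕ) →
    1 ≤ n → l ≤ 2 * n → t ≤ n →
    t ≤ l ⊓ (2 * n ∸ l) → 2 ∣ (l ∸ t) →
    ∀ (a : List ℕ) → IsSpT n t a →
    (∀ x → x ∈ a → 𝐬 x ∉ a) →
    All (λ k → 0ℤ ℤ.≤ k × (+ 2) ℤ.∣ k) (runLengths l t a)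
    × IsPreimage n l a (preimage l t a)
    × (∀ T′ → IsPreimage n l a T′ → T′ ≡ preimage l t a)
theorem2 n l t _ l≤2n _ t≤l⊓[2n∸l] (divides k l∸t≡2k) a spt free
  -- Evenness of `l - t` together with `t ≤ l` turns `l` into `k * 2 + t`, where `k` is the number
  -- of slots to fill.
  with refl ← trans (sym (ℕ.m∸n+n≡m (ℕ.m≤n⊓o⇒m≤n l (2 * n ∸ l) t≤l⊓[2n∸l]))) (cong (λ x → x + t) l∸t≡2k)
  with cs , len , refl ← encode-SST (IsSpT.isSST spt) =
    subst (All _) (sym (runLengths-decode k t nf))
      (All.map⁺ (All.universal (λ j → ℤ.+≤+ z≤n , divides j refl)
        (firstBlock k cs ∷ laterBlocks k cs)))
  , subst (IsPreimage n l (decode 0 cs)) (sym (preimage-decode k t nf k≤))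
      (fill-IsPreimage k t nf k≤ len lenₐ)
  , λ _ → preimage-unique k t lenₐ free
  where
  lenₐ = IsSST.length≡ (IsSpT.isSST spt)
  nf = 𝐬-free⇒NoFull 0 cs refl free
  k≤ = enough-empties k t nf len lenₐ l≤2n (ℕ.m≤n⊓o⇒m≤o l (2 * n ∸ l) t≤l⊓[2n∸l])
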